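{- Let $P$ be a connected poset such that $\check{P}$ is ranked, with rank function $\rho$. Then $\mathcal{L}(P)$ is centrally-symmetric with respect to $\rho$, i.e., $\rho - \mathcal{L}(P) = \mathcal{L}(P)$, where $\rho - \mathcal{L}(P) = \{\rho|_P - f : f \in \mathcal{L}(P)\}$.
   Context: All posets are finite. For a poset $(P,\preceq)$, $a \lessdot b$ denotes a cover relation, and $\check{P} = P \cup \{\hat 0\}$ is $P$ with a new minimum $\hat 0$ adjoined (even if $P$ already has a minimum). A poset is connected if its Hasse diagram is connected. A poset is ranked if for all elements $a,b$ all maximal chains in the interval $[a,b]$ have the same length. For $\check{P}$, which has the minimum $\hat 0$, this is equivalent to the existence of a (unique) rank function $\rho : \check{P} \to \mathbb{Z}_{\ge 0}$ with $\rho(\hat 0) = 0$ and $\rho(b) = \rho(a)+1$ whenever $a \lessdot b$ in $\check{P}$. Lipschitz polytope: $\mathcal{L}(P) \subset \mathbb{R}^P$ is the set of all $f : P \to \mathbb{R}$ with $0 \le f(a) \le 1$ for every minimal element $a$ of $P$ and $0 \le f(b)-f(a) \le 1$ for every cover relation $a \lessdot b$ in $P$. -}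

module Defs where

open import Data.Fin.Base using (Fin; zero; suc)
open import Data.Integer.Base using (+_)
open import Data.List.Base using (List; length)
open import Data.List.Membership.Propositional using () renaming (_∈_ to _∈ˡ_)
open import Data.List.Relation.Binary.Subset.Propositional using () renaming (_⊆_ to _⊆ˡ_)
open import Data.List.Relation.Unary.All using (All)
open import Data.List.Relation.Unary.Linked using (Linked)
open import Data.Nat.Base as ℕ using (ℕ)
import Data.Nat.Properties as ℕ
open import Data.Product.Base using (∃-syntax; _×_; _,_; proj₁; proj₂)
open import Data.Rational.Base as ℚ using (ℚ; 0ℚ; 1ℚ; ½)
import Data.Rational.Properties as ℚ
open import Data.Rational.Solver using (module +-*-Solver)
open import Function.Bundles using (_↔_; mk↔ₛ′; Inverse)
open import Level using (Level; _⊔_) renaming (suc to lsuc)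
open import Relation.Binary.Construct.Add.Infimum.NonStrict using (_≤₋_; ≤₋-isPartialOrder-≡)
open import Relation.Binary.Construct.Closure.Equivalence using (EqClosure)
import Relation.Binary.Construct.NonStrictToStrict as ToStrict
open import Relation.Binary.Core using (Rel)
open import Relation.Binary.PropositionalEquality
  using (_≡_; refl; sym; trans; cong; subst)
open import Relation.Binary.Structures using (IsPartialOrder)
open import Relation.Nullary.Construct.Add.Infimum using (_₋; ⊥₋; [_])
open import Relation.Nullary.Negation.Core using (¬_)
open import Relation.Unary using (Pred)

------------------------------------------------------------------------
-- Real numbers: Cauchy sequences of rationals, regarded up to _≈_.

record ℝ : Set where
  constructor mkℝ
  field
    seq    : ℕ → ℚ
    cauchy : ∀ ε → 0ℚ ℚ.< ε → ∃[ N ] ∀ m n → N ℕ.≤ m → N ℕ.≤ n →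
             ℚ.∣ seq m ℚ.- seq n ∣ ℚ.< ε

open ℝ public

infix 4 _≈_ _≤_

_≈_ : Rel ℝ _
x ≈ y = ∀ ε → 0ℚ ℚ.< ε → ∃[ N ] ∀ n → N ℕ.≤ n → ℚ.∣ seq x n ℚ.- seq y n ∣ ℚ.< ε

_≤_ : Rel ℝ _
x ≤ y = ∀ ε → 0ℚ ℚ.< ε → ∃[ N ] ∀ n → N ℕ.≤ n → seq x n ℚ.< seq y n ℚ.+ ε

fromℚ : ℚ → ℝ
fromℚ q = mkℝ (λ _ → q) λ ε 0<ε →
  0 , λ _ _ _ _ → subst (ℚ._< ε) (sym (cong ℚ.∣_∣ (ℚ.+-inverseʳ q))) 0<ε

fromℕ : ℕ → ℝ
fromℕ n = fromℚ (+ n ℚ./ 1)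

0ℝ 1ℝ : ℝ
0ℝ = fromℚ 0ℚ
1ℝ = fromℚ 1ℚ

private
  half-pos : ∀ {ε} → 0ℚ ℚ.< ε → 0ℚ ℚ.< ½ ℚ.* ε
  half-pos {ε} 0<ε = subst (ℚ._< ½ ℚ.* ε) (ℚ.*-zeroʳ ½) (ℚ.*-monoʳ-<-pos ½ 0<ε)

  halves : ∀ ε → ½ ℚ.* ε ℚ.+ ½ ℚ.* ε ≡ ε
  halves ε = trans (sym (ℚ.*-distribʳ-+ ε ½ ½)) (ℚ.*-identityˡ ε)

  sub-swap : ∀ p q r s → (p ℚ.- q) ℚ.- (r ℚ.- s) ≡ (p ℚ.- r) ℚ.- (q ℚ.- s)
  sub-swap = solve 4 (λ p q r s → (p :- q) :- (r :- s) := (p :- r) :- (q :- s)) refl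
    where open +-*-Solver

infixl 6 _-_

_-_ : ℝ → ℝ → ℝ
x - y = mkℝ (λ n → seq x n ℚ.- seq y n) λ ε 0<ε →
  let (M , xM) = cauchy x (½ ℚ.* ε) (half-pos 0<ε)
      (N , yN) = cauchy y (½ ℚ.* ε) (half-pos 0<ε)
  in M ℕ.⊔ N , λ m n K≤m K≤n →
    let open ℚ.≤-Reasoning
        dx = seq x m ℚ.- seq x n
        dy = seq y m ℚ.- seq y n
    in begin-strict
      ℚ.∣ (seq x m ℚ.- seq y m) ℚ.- (seq x n ℚ.- seq y n) ∣
        ≡⟨ cong ℚ.∣_∣ (sub-swap (seq x m) (seq y m) (seq x n) (seq y n)) ⟩
      ℚ.∣ dx ℚ.- dy ∣
        ≤⟨ ℚ.∣p-q∣≤∣p∣+∣q∣ dx dy ⟩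
      ℚ.∣ dx ∣ ℚ.+ ℚ.∣ dy ∣
        <⟨ ℚ.+-mono-< (xM m n (ℕ.m⊔n≤o⇒m≤o M N K≤m) (ℕ.m⊔n≤o⇒m≤o M N K≤n))
                      (yN m n (ℕ.m⊔n≤o⇒n≤o M N K≤m) (ℕ.m⊔n≤o⇒n≤o M N K≤n)) ⟩
      ½ ℚ.* ε ℚ.+ ½ ℚ.* ε
        ≡⟨ halves ε ⟩
      ε ∎

------------------------------------------------------------------------
-- Finite posets

record FinitePoset (c ℓ : Level) : Set (lsuc (c ⊔ ℓ)) where
  infix 4 _≼_ _≺_ _⋖_
  field
    Carrier        : Set c
    _≼_            : Rel Carrier ℓ
    isPartialOrder : IsPartialOrder _≡_ _≼_
    finite         : ∃[ n ] Carrier ↔ Fin n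

  _≺_ : Rel Carrier (c ⊔ ℓ)
  _≺_ = ToStrict._<_ _≡_ _≼_

  _⋖_ : Rel Carrier (c ⊔ ℓ)
  a ⋖ b = a ≺ b × ¬ (∃[ x ] a ≺ x × x ≺ b)

  Minimal : Pred Carrier (c ⊔ ℓ)
  Minimal a = ∀ b → b ≼ a → b ≡ a

  Connected : Set (c ⊔ ℓ)
  Connected = ∀ a b → EqClosure _⋖_ a b

  -- A chain is represented by the list of its elements in increasing order.
  ChainIn : (a b : Carrier) → Pred (List Carrier) (c ⊔ ℓ)
  ChainIn a b xs = Linked _≺_ xs × All (λ x → a ≼ x × x ≼ b) xs

  MaximalChainIn : (a b : Carrier) → Pred (List Carrier) (c ⊔ ℓ)
  MaximalChainIn a b xs =
    ChainIn a b xs × (∀ ys → ChainIn a b ys → xs ⊆ˡ ys → ys ⊆ˡ xs)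

  -- The length of a chain is its number of elements minus one, so equality of
  -- lengths amounts to equality of the numbers of elements.
  Ranked : Set (c ⊔ ℓ)
  Ranked = ∀ a b xs ys → MaximalChainIn a b xs → MaximalChainIn a b ys →
           length xs ≡ length ys

-- The new minimum ⊥₋ is always adjoined; elements of P appear as [ a ].
withBottom : ∀ {c ℓ} → FinitePoset c ℓ → FinitePoset c (c ⊔ ℓ)
withBottom P = record
  { Carrier        = Carrier ₋
  ; _≼_            = _≤₋_ _≼_
  ; isPartialOrder = ≤₋-isPartialOrder-≡ _≼_ isPartialOrder
  ; finite         = ℕ.suc n , mk↔ₛ′ to′ from′ to∘from from∘to
  }
  where
  open FinitePoset P
  n = proj₁ finite
  open Inverse (proj₂ finite) using (to; from; strictlyInverseˡ; strictlyInverseʳ)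

  to′ : Carrier ₋ → Fin (ℕ.suc n)
  to′ ⊥₋    = zero
  to′ [ a ] = suc (to a)

  from′ : Fin (ℕ.suc n) → Carrier ₋
  from′ zero    = ⊥₋
  from′ (suc i) = [ from i ]

  to∘from : ∀ i → to′ (from′ i) ≡ i
  to∘from zero    = refl
  to∘from (suc i) = cong suc (strictlyInverseˡ i)

  from∘to : ∀ a → from′ (to′ a) ≡ a
  from∘to ⊥₋    = refl
  from∘to [ a ] = cong [_] (strictlyInverseʳ a)

module _ {c ℓ} (P : FinitePoset c ℓ) where
  open FinitePoset P using (Carrier; Minimal; _⋖_)
  private module P̌ = FinitePoset (withBottom P)

  IsRankFunction : Pred (P̌.Carrier → ℕ) (c ⊔ ℓ)
  IsRankFunction ρ = ρ ⊥₋ ≡ 0 × (∀ a b → a P̌.⋖ b → ρ b ≡ ρ a ℕ.+ 1)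

  Lipschitz : Pred (Carrier → ℝ) (c ⊔ ℓ)
  Lipschitz f =
      (∀ a → Minimal a → 0ℝ ≤ f a × f a ≤ 1ℝ)
    × (∀ a b → a ⋖ b → 0ℝ ≤ f b - f a × f b - f a ≤ 1ℝ)

  restrict : (P̌.Carrier → ℕ) → Carrier → ℝ
  restrict ρ a = fromℕ (ρ [ a ])

-- The set h - S; points of ℝ^A are compared pointwise by _≈_.
reflect : ∀ {a s} {A : Set a} → (A → ℝ) → Pred (A → ℝ) s → Pred (A → ℝ) (a ⊔ s)
reflect {A = A} h S g = ∃[ f ] S f × (∀ (x : A) → g x ≈ h x - f x)

{-# OPTIONS --safe #-}
-- As ρ rises by exactly one along covers of P̌, replacing f by ρ - f turns
-- each defining quantity t of the Lipschitz polytope into 1 - t, and the unit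
-- interval is symmetric under t ↦ 1 - t. The map f ↦ ρ - f is an involution.
module Submission where

open import Defs
open import Data.Integer.Base using (+_; -[1+_])
open import Data.Nat.Base as ℕ using (ℕ)
import Data.Nat.Properties as ℕ
open import Data.Product.Base using (_×_; _,_; proj₁; proj₂)
open import Data.Rational.Base as ℚ using (ℚ; 0ℚ; 1ℚ; ½)
import Data.Rational.Properties as ℚ
import Data.Rational.Unnormalised.Base as ℚᵘ
import Data.Rational.Unnormalised.Properties as ℚᵘ
open import Data.Rational.Solver using (module +-*-Solver)
import Data.Integer.Solver as ℤ
open import Relation.Binary.Construct.Add.Infimum.NonStrict using (⊥₋≤_; [_])
open import Relation.Binary.PropositionalEquality
  using (_≡_; refl; sym; trans; cong; subst)
open import Relation.Nullary.Construct.Add.Infimum using (_₋; ⊥₋; [_]; []-injective)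
open import Relation.Unary using (_≐_)

InUnit : ℝ → Set
InUnit x = 0ℝ ≤ x × x ≤ 1ℝ

half-pos : ∀ {ε} → 0ℚ ℚ.< ε → 0ℚ ℚ.< ½ ℚ.* ε
half-pos {ε} 0<ε = subst (ℚ._< ½ ℚ.* ε) (ℚ.*-zeroʳ ½) (ℚ.*-monoʳ-<-pos ½ 0<ε)

halves : ∀ ε → ½ ℚ.* ε ℚ.+ ½ ℚ.* ε ≡ ε
halves ε = trans (sym (ℚ.*-distribʳ-+ ε ½ ½)) (ℚ.*-identityˡ ε)

p≤∣p∣ : ∀ p → p ℚ.≤ ℚ.∣ p ∣
p≤∣p∣ (ℚ.mkℚ (+ _)      _ _) = ℚ.≤-refl
p≤∣p∣ p@(ℚ.mkℚ -[1+ _ ] _ _) = ℚ.≤-trans (ℚ.nonPositive⁻¹ p) (ℚ.0≤∣p∣ p)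

∣p∣<⇒-p< : ∀ p {q} → ℚ.∣ p ∣ ℚ.< q → ℚ.- p ℚ.< q
∣p∣<⇒-p< p ∣p∣<q =
  ℚ.≤-<-trans (p≤∣p∣ (ℚ.- p)) (subst (ℚ._< _) (sym (ℚ.∣-p∣≡∣p∣ p)) ∣p∣<q)

-- Algebraic identities between reals are checked term by term in ℚ, where the ring solver applies.
-- Propositional equality of reals would also compare the `cauchy` proofs.
≈-by-seq : ∀ x y z → x ≈ y → (∀ n → seq y n ≡ seq z n) → x ≈ z
≈-by-seq x y z x≈y y≡z ε 0<ε =
  let (N , p) = x≈y ε 0<ε
  in N , λ n N≤n → subst (λ q → ℚ.∣ seq x n ℚ.- q ∣ ℚ.< ε) (y≡z n) (p n N≤n)

≈-refl : ∀ x → x ≈ x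
≈-refl x ε 0<ε =
  0 , λ n _ → subst (ℚ._< ε) (sym (cong ℚ.∣_∣ (ℚ.+-inverseʳ (seq x n)))) 0<ε

-‿cong : ∀ x x′ y y′ → x ≈ x′ → y ≈ y′ → x - y ≈ x′ - y′
-‿cong x x′ y y′ x≈x′ y≈y′ ε 0<ε =
  let (M , p) = x≈x′ (½ ℚ.* ε) (half-pos 0<ε)
      (N , q) = y≈y′ (½ ℚ.* ε) (half-pos 0<ε)
  in M ℕ.⊔ N , λ n K≤n →
    let open ℚ.≤-Reasoning
        dx = seq x n ℚ.- seq x′ n
        dy = seq y n ℚ.- seq y′ n
    in begin-strict
      ℚ.∣ (seq x n ℚ.- seq y n) ℚ.- (seq x′ n ℚ.- seq y′ n) ∣
        ≡⟨ cong ℚ.∣_∣ (interchange (seq x n) (seq y n) (seq x′ n) (seq y′ n)) ⟩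
      ℚ.∣ dx ℚ.- dy ∣
        ≤⟨ ℚ.∣p-q∣≤∣p∣+∣q∣ dx dy ⟩
      ℚ.∣ dx ∣ ℚ.+ ℚ.∣ dy ∣
        <⟨ ℚ.+-mono-< (p n (ℕ.m⊔n≤o⇒m≤o M N K≤n)) (q n (ℕ.m⊔n≤o⇒n≤o M N K≤n)) ⟩
      ½ ℚ.* ε ℚ.+ ½ ℚ.* ε
        ≡⟨ halves ε ⟩
      ε ∎
  where
  interchange : ∀ p q r s → (p ℚ.- q) ℚ.- (r ℚ.- s) ≡ (p ℚ.- r) ℚ.- (q ℚ.- s)
  interchange = solve 4 (λ p q r s → (p :- q) :- (r :- s) := (p :- r) :- (q :- s)) refl
    where open +-*-Solver

-- Each bound on `x` comes from the opposite bound on `y`. The tolerance `ε` is split in two: one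
-- half for the error `d` in `x ≈ 1ℝ - y`, one for the slack in the bound on `y`.
InUnit-complement : ∀ x y → x ≈ 1ℝ - y → InUnit y → InUnit x
InUnit-complement x y x≈1-y (0≤y , y≤1) = lower , upper
  where
  d : ℕ → ℚ
  d n = seq x n ℚ.- (1ℚ ℚ.- seq y n)

  lower : 0ℝ ≤ x
  lower ε 0<ε =
    let δ = ½ ℚ.* ε
        (M , p) = x≈1-y δ (half-pos 0<ε)
        (N , q) = y≤1 δ (half-pos 0<ε)
    in M ℕ.⊔ N , λ n K≤n →
      let open ℚ.≤-Reasoning
          -d<δ = ∣p∣<⇒-p< (d n) (p n (ℕ.m⊔n≤o⇒m≤o M N K≤n))
      in begin-strict
        0ℚ
          -- The first bracket collects the two terms that get estimated; the remainder `d n - y`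
          -- equals `x - 1`.
          ≡⟨ cancel (d n) (seq y n) ⟩
        (ℚ.- d n ℚ.+ seq y n) ℚ.+ (d n ℚ.- seq y n)
          <⟨ ℚ.+-monoˡ-< (d n ℚ.- seq y n)
               (ℚ.+-mono-< -d<δ (q n (ℕ.m⊔n≤o⇒n≤o M N K≤n))) ⟩
        (δ ℚ.+ (1ℚ ℚ.+ δ)) ℚ.+ (d n ℚ.- seq y n)
          ≡⟨ collect 1ℚ (seq x n) (seq y n) δ ⟩
        seq x n ℚ.+ (δ ℚ.+ δ)
          ≡⟨ cong (seq x n ℚ.+_) (halves ε) ⟩
        seq x n ℚ.+ ε ∎
    where
    open +-*-Solver
    cancel : ∀ p q → 0ℚ ≡ (ℚ.- p ℚ.+ q) ℚ.+ (p ℚ.- q)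
    cancel = solve 2 (λ p q → con 0ℚ := (:- p :+ q) :+ (p :- q)) refl
    collect : ∀ u p q δ →
      (δ ℚ.+ (u ℚ.+ δ)) ℚ.+ ((p ℚ.- (u ℚ.- q)) ℚ.- q) ≡ p ℚ.+ (δ ℚ.+ δ)
    collect = solve 4 (λ u p q δ →
      (δ :+ (u :+ δ)) :+ ((p :- (u :- q)) :- q) := p :+ (δ :+ δ)) refl

  upper : x ≤ 1ℝ
  upper ε 0<ε =
    let δ = ½ ℚ.* ε
        (M , p) = x≈1-y δ (half-pos 0<ε)
        (N , q) = 0≤y δ (half-pos 0<ε)
    in M ℕ.⊔ N , λ n K≤n →
      let open ℚ.≤-Reasoning
          d<δ = ℚ.≤-<-trans (p≤∣p∣ (d n)) (p n (ℕ.m⊔n≤o⇒m≤o M N K≤n))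
      in begin-strict
        seq x n
          -- The summand `0ℚ` is inserted so that `0ℝ ≤ y` can replace it by `y + δ`, whose `y` then
          -- cancels.
          ≡⟨ expand 1ℚ (seq x n) (seq y n) ⟩
        (d n ℚ.+ 0ℚ) ℚ.+ (1ℚ ℚ.- seq y n)
          <⟨ ℚ.+-monoˡ-< (1ℚ ℚ.- seq y n)
               (ℚ.+-mono-< d<δ (q n (ℕ.m⊔n≤o⇒n≤o M N K≤n))) ⟩
        (δ ℚ.+ (seq y n ℚ.+ δ)) ℚ.+ (1ℚ ℚ.- seq y n)
          ≡⟨ collect 1ℚ (seq y n) δ ⟩
        1ℚ ℚ.+ (δ ℚ.+ δ)
          ≡⟨ cong (1ℚ ℚ.+_) (halves ε) ⟩
        1ℚ ℚ.+ ε ∎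
    where
    open +-*-Solver
    expand : ∀ u p q → p ≡ ((p ℚ.- (u ℚ.- q)) ℚ.+ 0ℚ) ℚ.+ (u ℚ.- q)
    expand = solve 3 (λ u p q →
      p := ((p :- (u :- q)) :+ con 0ℚ) :+ (u :- q)) refl
    collect : ∀ u q δ →
      (δ ℚ.+ (q ℚ.+ δ)) ℚ.+ (u ℚ.- q) ≡ u ℚ.+ (δ ℚ.+ δ)
    collect = solve 3 (λ u q δ →
      (δ :+ (q :+ δ)) :+ (u :- q) := u :+ (δ :+ δ)) refl

-- `_/_` reduces fractions by a gcd that is stuck on a variable `n`. Among unnormalised fractions
-- the claim is an integer identity after cross-multiplication.
/1-homo-+1 : ∀ n → + (n ℕ.+ 1) ℚ./ 1 ≡ + n ℚ./ 1 ℚ.+ 1ℚ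
/1-homo-+1 n = ℚ.toℚᵘ-injective (begin
  ℚ.toℚᵘ (+ (n ℕ.+ 1) ℚ./ 1)         ≈⟨ ℚ.toℚᵘ-fromℚᵘ (ℚᵘ.mkℚᵘ (+ (n ℕ.+ 1)) 0) ⟩
  ℚᵘ.mkℚᵘ (+ (n ℕ.+ 1)) 0            ≈⟨ ℚᵘ.*≡* (homo (+ n)) ⟩
  ℚᵘ.mkℚᵘ (+ n) 0 ℚᵘ.+ ℚᵘ.1ℚᵘ        ≈⟨ ℚᵘ.+-congˡ ℚᵘ.1ℚᵘ (ℚ.toℚᵘ-fromℚᵘ (ℚᵘ.mkℚᵘ (+ n) 0)) ⟨
  ℚ.toℚᵘ (+ n ℚ./ 1) ℚᵘ.+ ℚᵘ.1ℚᵘ     ≈⟨ ℚ.toℚᵘ-homo-+ (+ n ℚ./ 1) 1ℚ ⟨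
  ℚ.toℚᵘ (+ n ℚ./ 1 ℚ.+ 1ℚ)          ∎)
  where
  open ℚᵘ.≃-Reasoning
  open ℤ.+-*-Solver
  homo = solve 1 (λ i → (i :+ con (+ 1)) :* con (+ 1)
                   := (i :* con (+ 1) :+ con (+ 1) :* con (+ 1)) :* con (+ 1)) refl

module _ {c ℓ} (P : FinitePoset c ℓ) where
  open FinitePoset P
  private module P̌ = FinitePoset (withBottom P)

  -- This makes the condition at a minimal element another cover condition, with value 0 at the new
  -- bottom. Anything strictly between would lie in P, against minimality.
  minimal⇒⊥₋⋖ : ∀ {a} → Minimal a → ⊥₋ P̌.⋖ [ a ]
  minimal⇒⊥₋⋖ {a} min = ((⊥₋≤ [ a ]) , λ ()) , λ where
    (⊥₋    , (_ , ⊥≢⊥) , _)       → ⊥≢⊥ refl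
    ([ b ] , _ , ([ b≼a ] , b≢a)) → b≢a (cong [_] (min b b≼a))

  -- No `[ a ]` lies below `⊥₋`, so an element strictly in between would already come from P.
  ⋖⇒[]⋖[] : ∀ {a b} → a ⋖ b → [ a ] P̌.⋖ [ b ]
  ⋖⇒[]⋖[] ((a≼b , a≢b) , none) = ([ a≼b ] , λ e → a≢b ([]-injective e)) , λ where
    ([ x ] , ([ a≼x ] , a≢x) , ([ x≼b ] , x≢b)) →
      none (x , (a≼x , λ e → a≢x (cong [_] e)) , (x≼b , λ e → x≢b (cong [_] e)))

  module _ {ρ : Carrier ₋ → ℕ} (isRank : IsRankFunction P ρ) where
    private
      ρ⊥ = proj₁ isRank
      ρ⋖ = proj₂ isRank
      h  = restrict P ρ

    restrict-minimal : ∀ {a} → Minimal a → h a ≡ 1ℝ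
    restrict-minimal {a} min =
      -- `fromℕ (0 + 1)` computes to `1ℝ`, so here even propositional equality of reals is
      -- available.
      cong fromℕ (trans (ρ⋖ ⊥₋ [ a ] (minimal⇒⊥₋⋖ min)) (cong (ℕ._+ 1) ρ⊥))

    restrict-⋖ : ∀ {a b} → a ⋖ b → ∀ n → seq (h b) n ≡ seq (h a) n ℚ.+ 1ℚ
    restrict-⋖ {a} {b} a⋖b _ =
      trans (cong (λ n → + n ℚ./ 1) (ρ⋖ [ a ] [ b ] (⋖⇒[]⋖[] a⋖b))) (/1-homo-+1 (ρ [ a ]))

    -- Asking only for `g` pointwise `≈` to `h - f` lets this serve both inclusions: one supplies
    -- such a `g`, the other takes the difference itself.
    Lipschitz-complement : ∀ f g → (∀ x → g x ≈ h x - f x) → Lipschitz P f → Lipschitz P g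
    Lipschitz-complement f g g≈h-f (f-min , f-⋖) =
        (λ a min → InUnit-complement (g a) (f a)
          (subst (λ r → g a ≈ r - f a) (restrict-minimal min) (g≈h-f a)) (f-min a min))
      , (λ a b a⋖b → InUnit-complement (g b - g a) (f b - f a)
          (≈-by-seq (g b - g a) ((h b - f b) - (h a - f a)) (1ℝ - (f b - f a))
            (-‿cong (g b) (h b - f b) (g a) (h a - f a) (g≈h-f b) (g≈h-f a))
            -- Once `h b` is rewritten as `h a + 1`, the rank of `a` cancels and only the jump 1
            -- remains.
            λ n → trans
              (cong (λ r → (r ℚ.- seq (f b) n) ℚ.- (seq (h a) n ℚ.- seq (f a) n))
                    (restrict-⋖ a⋖b n))
              (difference (seq (h a) n) 1ℚ (seq (f b) n) (seq (f a) n)))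
          (f-⋖ a b a⋖b))
      where
      open +-*-Solver
      difference : ∀ r u p q → ((r ℚ.+ u) ℚ.- p) ℚ.- (r ℚ.- q) ≡ u ℚ.- (p ℚ.- q)
      difference = solve 4 (λ r u p q →
        ((r :+ u) :- p) :- (r :- q) := u :- (p :- q)) refl

x≈y-[y-x] : ∀ x y → x ≈ y - (y - x)
x≈y-[y-x] x y = ≈-by-seq x x (y - (y - x)) (≈-refl x)
  λ n → involutive (seq x n) (seq y n)
  where
  open +-*-Solver
  involutive : ∀ p q → p ≡ q ℚ.- (q ℚ.- p)
  involutive = solve 2 (λ p q → p := q :- (q :- p)) refl

proposition4p1 : ∀ {c ℓ} (P : FinitePoset c ℓ) →
    FinitePoset.Connected P →
    FinitePoset.Ranked (withBottom P) →
    (ρ : FinitePoset.Carrier P ₋ → ℕ) → IsRankFunction P ρ →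
    reflect (restrict P ρ) (Lipschitz P) ≐ Lipschitz P
proposition4p1 P _ _ ρ isRank =
    (λ {g} (f , f∈L , g≈ρ-f) → Lipschitz-complement P isRank f g g≈ρ-f f∈L)
  , (λ {g} g∈L →
      -- By the involution, the preimage of `g` under the reflection is its own reflection.
      let ρ-g = λ x → restrict P ρ x - g x
      in ρ-g , Lipschitz-complement P isRank g ρ-g (λ x → ≈-refl (ρ-g x)) g∈L
             , λ x → x≈y-[y-x] (g x) (restrict P ρ x))
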